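{- The tableau system $\mathcal{T}\mathbf{P}$ is sound with respect to preferential models: for every set $\Gamma$ of formulas of $\mathcal{L}_P$, if there is a closed tableau for $\Gamma$ in $\mathcal{T}\mathbf{P}$, then $\Gamma$ is unsatisfiable (i.e. there are no preferential model $\mathcal{M}$ and world $w$ of $\mathcal{M}$ with $\mathcal{M},w\models F$ for all $F\in\Gamma$).
   Context: **Language.** Let $\mathit{ATM}$ be a set of propositional variables. Propositional formulas ($A,B,C,\dots$) are built from $\mathit{ATM}$ with $\neg,\wedge,\vee,\rightarrow$. The language $\mathcal{L}$ is the least set containing all propositional formulas and all conditionals $A\mathrel{|\!\sim}B$ ($A,B$ propositional), closed under boolean combinations. $\mathcal{L}_P$ is obtained from $\mathcal{L}$ by adding the formulas $\Box\neg A$ ($A$ propositional) and closing under boolean combinations (antecedents and consequents of conditionals remain propositional). $F,G$ denote arbitrary formulas. **Semantics.** A preferential model is $\mathcal{M}=\langle\mathcal{W},<,V\rangle$ with $\mathcal{W}$ a non-empty set of worlds, $<$ an irreflexive and transitive relation on $\mathcal{W}$, $V:\mathcal{W}\to \mathrm{pow}(\mathit{ATM})$ giving the atoms true at each world. Boolean combinations are evaluated classically at worlds. For $A$ propositional, $Min_<(A)=\{w\in\mathcal{W}\mid \mathcal{M},w\models A$ and for all $w'<w$, $\mathcal{M},w'\not\models A\}$. $\mathcal{M},w\models A\mathrel{|\!\sim}B$ iff for all $w'\in Min_<(A)$, $\mathcal{M},w'\models B$. $\mathcal{M},w\models\Box\neg A$ iff $\mathcal{M},w'\models\neg A$ for all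 $w'<w$. Smoothness condition (part of the definition of model): for every propositional $A$ and world $w$, if $\mathcal{M},w\models A$ then $w\in Min_<(A)$ or there is $w'\in Min_<(A)$ with $w'<w$. **Calculus $\mathcal{T}\mathbf{P}$.** Nodes are sets of formulas; $\Gamma,F$ means $\Gamma\cup\{F\}$. Put $\Gamma^{\Box}=\{\Box\neg A\mid\Box\neg A\in\Gamma\}$, $\Gamma^{\Box^{\downarrow}}=\{\neg A\mid\Box\neg A\in\Gamma\}$, $\Gamma^{|\!\sim^{\pm}}=\{A\mathrel{|\!\sim}B\mid A\mathrel{|\!\sim}B\in\Gamma\}\cup\{\neg(A\mathrel{|\!\sim}B)\mid\neg(A\mathrel{|\!\sim}B)\in\Gamma\}$. Rules (premise $\leadsto$ conclusions, separated by $\mid$): - axiom (AX): $\Gamma,P,\neg P$ with $P\in\mathit{ATM}$; - $\Gamma,\neg\neg F\leadsto\Gamma,F$; $\ \Gamma,F\wedge G\leadsto\Gamma,F,G$; $\ \Gamma,\neg(F\wedge G)\leadsto\Gamma,\neg F\mid\Gamma,\neg G$; $\ \Gamma,F\vee G\leadsto\Gamma,F\mid\Gamma,G$; $\ \Gamma,\neg(F\vee G)\leadsto\Gamma,\neg F,\neg G$; $\ \Gamma,F\rightarrow G\leadsto\Gamma,\neg F\mid\Gamma,G$; $\ \Gamma,\neg(F\rightarrow G)\leadsto\Gamma,F,\neg G$; - $(|\!\sim^+)$: $\Gamma,A\mathrel{|\!\sim}B\leadsto\Gamma,\neg A,A\mathrel{|\!\sim}B\mid\Gamma,\neg\Box\neg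 A,A\mathrel{|\!\sim}B\mid\Gamma,B,A\mathrel{|\!\sim}B$; - $(|\!\sim^-)$: $\Gamma,\neg(A\mathrel{|\!\sim}B)\leadsto A,\Box\neg A,\neg B,\Gamma^{|\!\sim^{\pm}}$; - $(\Box^-)$: $\Gamma,\neg\Box\neg A\leadsto\Gamma^{\Box},\Gamma^{\Box^{\downarrow}},\Gamma^{|\!\sim^{\pm}},A,\Box\neg A$. A tableau for $\Gamma$ is a tree with root $\Gamma$ in which the children of each non-leaf node are the conclusions of a rule applied to that node. A branch is closed if one of its nodes is an instance of (AX); a tableau is closed if all its branches are closed. -}

module Defs where

open import Level using (Level; _⊔_) renaming (suc to lsuc)
open import Data.List using (List; []; _∷_)
open import Data.List.Relation.Unary.All as All using (All)
open import Data.List.Relation.Unary.Any using (Any)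
import Data.List.Membership.Propositional as List
open import Data.Product using (Σ-syntax; ∃-syntax; _×_)
open import Data.Sum using (_⊎_)
open import Relation.Binary using (Rel; Irreflexive; Transitive)
open import Relation.Binary.PropositionalEquality using (_≡_)
open import Relation.Nullary using (¬_)
open import Relation.Unary using (Pred; _∈_; _∪_; ｛_｝; _≐_)

data Kind : Set where
  prop full : Kind

infix  9 ¬ᶠ_ □¬_
infixr 8 _∧ᶠ_
infixr 7 _∨ᶠ_
infixr 6 _→ᶠ_
infix  8 _∣~_

-- Formula ATM prop is the set of propositional formulas, Formula ATM full is
-- the language L_P.  □¬ A is the formula □¬A: the box and the negation
-- together form one constructor, as boxes occur in L_P only in this shape.
data Formula {a} (ATM : Set a) : Kind → Set a where
  atom : ∀ {k} → ATM → Formula ATM k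
  ¬ᶠ_  : ∀ {k} → Formula ATM k → Formula ATM k
  _∧ᶠ_ : ∀ {k} → Formula ATM k → Formula ATM k → Formula ATM k
  _∨ᶠ_ : ∀ {k} → Formula ATM k → Formula ATM k → Formula ATM k
  _→ᶠ_ : ∀ {k} → Formula ATM k → Formula ATM k → Formula ATM k
  _∣~_ : Formula ATM prop → Formula ATM prop → Formula ATM full
  □¬_  : Formula ATM prop → Formula ATM full

⌜_⌝ : ∀ {a} {ATM : Set a} → Formula ATM prop → Formula ATM full
⌜ atom p ⌝ = atom p
⌜ ¬ᶠ A ⌝   = ¬ᶠ ⌜ A ⌝
⌜ A ∧ᶠ B ⌝ = ⌜ A ⌝ ∧ᶠ ⌜ B ⌝
⌜ A ∨ᶠ B ⌝ = ⌜ A ⌝ ∨ᶠ ⌜ B ⌝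
⌜ A →ᶠ B ⌝ = ⌜ A ⌝ →ᶠ ⌜ B ⌝

-- The semantics is classical.  Instead of assuming excluded middle, the double
-- negations in the clauses for atoms and disjunctions make w ⊨ F
-- ¬¬-stable for every F; with excluded middle they can be erased.
module Satisfaction {a ℓ} {ATM : Set a} {W : Set ℓ}
                    (_<_ : Rel W ℓ) (V : W → Pred ATM ℓ) where

  infix 4 _⊨_

  mutual
    _⊨_ : ∀ {k} → W → Formula ATM k → Set ℓ
    w ⊨ atom p   = ¬ ¬ (p ∈ V w)
    w ⊨ ¬ᶠ F     = ¬ (w ⊨ F)
    w ⊨ (F ∧ᶠ G) = (w ⊨ F) × (w ⊨ G)
    w ⊨ (F ∨ᶠ G) = ¬ ¬ ((w ⊨ F) ⊎ (w ⊨ G))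
    w ⊨ (F →ᶠ G) = w ⊨ F → w ⊨ G
    w ⊨ (A ∣~ B) = ∀ w′ → w′ ∈ Min A → w′ ⊨ B
    w ⊨ (□¬ A)   = ∀ w′ → w′ < w → ¬ (w′ ⊨ A)

    Min : Formula ATM prop → Pred W ℓ
    Min A w = (w ⊨ A) × (∀ w′ → w′ < w → ¬ (w′ ⊨ A))

record PreferentialModel {a} (ATM : Set a) ℓ : Set (a ⊔ lsuc ℓ) where
  field
    W        : Set ℓ
    nonEmpty : W
    _<_      : Rel W ℓ
    irrefl   : Irreflexive _≡_ _<_
    trans    : Transitive _<_
    V        : W → Pred ATM ℓ

  open Satisfaction _<_ V public

  -- The double negation makes the disjunction and the existential classical.
  field
    smooth : ∀ (A : Formula ATM prop) w → w ⊨ A →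
             ¬ ¬ ((w ∈ Min A) ⊎ (∃[ w′ ] w′ ∈ Min A × w′ < w))

-- Sets of formulas, compared by extensional equality _≐_.
Node : ∀ {a} → Set a → Set (lsuc a)
Node {a} ATM = Pred (Formula ATM full) a

Satisfiable : ∀ {a} {ATM : Set a} ℓ → Node ATM → Set (a ⊔ lsuc ℓ)
Satisfiable {ATM = ATM} ℓ Γ =
  Σ[ M ∈ PreferentialModel ATM ℓ ]
    (let open PreferentialModel M in ∃[ w ] (∀ F → F ∈ Γ → w ⊨ F))

module _ {a} {ATM : Set a} where

  infixl 5 _,,_
  infix  10 _^□ _^□↓ _^∣~±

  _,,_ : Node ATM → Formula ATM full → Node ATM
  Γ ,, F = Γ ∪ ｛ F ｝

  _^□ : Node ATM → Node ATM
  (Γ ^□) F = ∃[ A ] (F ≡ □¬ A) × (□¬ A ∈ Γ)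

  _^□↓ : Node ATM → Node ATM
  (Γ ^□↓) F = ∃[ A ] (F ≡ ¬ᶠ ⌜ A ⌝) × (□¬ A ∈ Γ)

  _^∣~± : Node ATM → Node ATM
  (Γ ^∣~±) F =
    (∃[ A ] ∃[ B ] (F ≡ A ∣~ B) × (A ∣~ B ∈ Γ)) ⊎
    (∃[ A ] ∃[ B ] (F ≡ ¬ᶠ (A ∣~ B)) × (¬ᶠ (A ∣~ B) ∈ Γ))

  Axiom : Pred (Node ATM) (lsuc a)
  Axiom Δ = ∃[ Γ ] ∃[ p ] Δ ≐ (Γ ,, atom p ,, ¬ᶠ atom p)

  infix 3 _⇝_

  -- The context Γ may itself contain the principal formula, since Γ ,, F is
  -- a union of sets; a rule may thus keep or discard its principal formula.
  data _⇝_ : Node ATM → List (Node ATM) → Set (lsuc a) where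
    [¬¬]  : ∀ Γ F   → Γ ,, ¬ᶠ (¬ᶠ F) ⇝ (Γ ,, F) ∷ []
    [∧⁺]  : ∀ Γ F G → Γ ,, F ∧ᶠ G ⇝ (Γ ,, F ,, G) ∷ []
    [∧⁻]  : ∀ Γ F G → Γ ,, ¬ᶠ (F ∧ᶠ G) ⇝ (Γ ,, ¬ᶠ F) ∷ (Γ ,, ¬ᶠ G) ∷ []
    [∨⁺]  : ∀ Γ F G → Γ ,, F ∨ᶠ G ⇝ (Γ ,, F) ∷ (Γ ,, G) ∷ []
    [∨⁻]  : ∀ Γ F G → Γ ,, ¬ᶠ (F ∨ᶠ G) ⇝ (Γ ,, ¬ᶠ F ,, ¬ᶠ G) ∷ []
    [→⁺]  : ∀ Γ F G → Γ ,, F →ᶠ G ⇝ (Γ ,, ¬ᶠ F) ∷ (Γ ,, G) ∷ []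
    [→⁻]  : ∀ Γ F G → Γ ,, ¬ᶠ (F →ᶠ G) ⇝ (Γ ,, F ,, ¬ᶠ G) ∷ []
    [∣~⁺] : ∀ Γ A B → Γ ,, A ∣~ B ⇝
              (Γ ,, ¬ᶠ ⌜ A ⌝ ,, A ∣~ B) ∷
              (Γ ,, ¬ᶠ (□¬ A) ,, A ∣~ B) ∷
              (Γ ,, ⌜ B ⌝ ,, A ∣~ B) ∷ []
    [∣~⁻] : ∀ Γ A B → Γ ,, ¬ᶠ (A ∣~ B) ⇝
              (Γ ^∣~± ,, ⌜ A ⌝ ,, □¬ A ,, ¬ᶠ ⌜ B ⌝) ∷ []
    [□⁻]  : ∀ Γ A → Γ ,, ¬ᶠ (□¬ A) ⇝
              ((Γ ^□ ∪ Γ ^□↓ ∪ Γ ^∣~±) ,, ⌜ A ⌝ ,, □¬ A) ∷ []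

  -- Tableaux are well-founded; all rules branch finitely, so they are finite
  -- trees.
  data Tableau : Node ATM → Set (lsuc a) where
    leaf : ∀ {Γ} → Tableau Γ
    node : ∀ {Γ Δ Δs} → Γ ≐ Δ → Δ ⇝ Δs → All Tableau Δs → Tableau Γ

  data Branch : ∀ {Γ} → Tableau Γ → Set (lsuc a) where
    end  : ∀ {Γ} → Branch (leaf {Γ})
    step : ∀ {Γ Δ Δs} {eq : Γ ≐ Δ} {r : Δ ⇝ Δs} {ts : All Tableau Δs}
           {Δ′} (i : Δ′ List.∈ Δs) →
           Branch (All.lookup ts i) → Branch (node eq r ts)

  nodes : ∀ {Γ} {t : Tableau Γ} → Branch t → List (Node ATM)
  nodes {Γ} end        = Γ ∷ []
  nodes {Γ} (step i b) = Γ ∷ nodes b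

  ClosedBranch : ∀ {Γ} {t : Tableau Γ} → Branch t → Set (lsuc a)
  ClosedBranch b = Any Axiom (nodes b)

  Closed : ∀ {Γ} → Tableau Γ → Set (lsuc a)
  Closed t = ∀ (b : Branch t) → ClosedBranch b

{-# OPTIONS --safe #-}
module Submission where

-- Soundness holds because every rule preserves satisfiability: if a world w of
-- a preferential model M satisfies the premise of a rule, then some world of
-- the same M satisfies one of its conclusions (rule-sound).  For the boolean
-- rules and for the rule for positive conditionals that world is w itself.
-- The two rules that discard part of the context move to another world v:
--
--   * a false conditional A ∣~ B gives a minimal A-world v refuting B;
--   * a false □¬ A gives an A-world below w, and smoothness turns it into a
--     minimal A-world v which, by transitivity, is still below w, so that
--     v satisfies both □¬ B and ¬ B whenever □¬ B is true at w.
--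
-- In both cases v satisfies □¬ A by minimality, and the conditionals and
-- negated conditionals true at w hold at v because their truth does not depend
-- on the world.
--
-- Starting from a satisfied root one can therefore follow satisfied nodes up
-- the tableau.  An instance of the axiom is never satisfied, so the branch
-- obtained is not closed (satisfied⇒¬closed).
--
-- Constructively, the conclusion and the new world exist only up to double
-- negation.  This suffices, as the goal is an absurdity; the proofs pass the
-- witnesses to a continuation k that refutes them.  Stability of truth under
-- double negation (⊨-stable) is what extracts from a false conditional a
-- minimal world refuting its consequent.

open import Level using (Level)
open import Data.Empty using (⊥-elim)
open import Data.List using (List)
open import Data.List.Relation.Unary.All as All using (All; _∷_)
open import Data.List.Relation.Unary.Any using (Any; here; there; tail)
import Data.List.Membership.Propositional as List
open import Data.Product using (Σ-syntax; ∃-syntax; _×_; _,_; proj₁; proj₂)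
open import Data.Sum using (inj₁; inj₂; [_,_]′)
open import Function using (_∘_)
open import Relation.Binary.PropositionalEquality using (refl)
open import Relation.Nullary using (¬_)
open import Relation.Unary using (_∈_; _⊆_)
open import Defs

module _ {a ℓ} {ATM : Set a} (M : PreferentialModel ATM ℓ) where

  open PreferentialModel M

  infix 4 _⊩_

  -- The world w satisfies every formula of the node Γ.
  _⊩_ : W → Node ATM → Set _
  w ⊩ Γ = ∀ F → F ∈ Γ → w ⊨ F

  ⊩-antitone : ∀ {w} {Γ Δ : Node ATM} → Γ ⊆ Δ → w ⊩ Δ → w ⊩ Γ
  ⊩-antitone Γ⊆Δ s F F∈Γ = s F (Γ⊆Δ F∈Γ)

  ⊩-extend : ∀ {w} {Γ : Node ATM} {F} → w ⊩ Γ → w ⊨ F → w ⊩ (Γ ,, F)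
  ⊩-extend s f F (inj₁ F∈Γ) = s F F∈Γ
  ⊩-extend s f F (inj₂ refl) = f

  ⊩-context : ∀ {w} {Γ : Node ATM} {F} → w ⊩ (Γ ,, F) → w ⊩ Γ
  ⊩-context = ⊩-antitone inj₁

  ⊩-principal : ∀ {w} {Γ : Node ATM} {F} → w ⊩ (Γ ,, F) → w ⊨ F
  ⊩-principal s = s _ (inj₂ refl)

  ¬-⊩-axiom : ∀ {w} {Γ : Node ATM} → w ⊩ Γ → ¬ Axiom Γ
  ¬-⊩-axiom s (Γ′ , p , _ , Δ⊆Γ) = ⊩-principal s′ (⊩-principal (⊩-context s′))
    where s′ = ⊩-antitone {Γ = Γ′ ,, atom p ,, ¬ᶠ atom p} Δ⊆Γ s

  -- The embedding of propositional formulas preserves and reflects truth; the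
  -- two directions depend on each other through negation and implication.
  mutual
    ⌜⌝-intro : ∀ {w} A → w ⊨ A → w ⊨ ⌜ A ⌝
    ⌜⌝-intro (atom p)  s       = s
    ⌜⌝-intro (¬ᶠ A)    s       = s ∘ ⌜⌝-elim A
    ⌜⌝-intro (A ∧ᶠ B)  (s , t) = ⌜⌝-intro A s , ⌜⌝-intro B t
    ⌜⌝-intro (A ∨ᶠ B)  s       = λ k → s
      [ k ∘ inj₁ ∘ ⌜⌝-intro A , k ∘ inj₂ ∘ ⌜⌝-intro B ]′
    ⌜⌝-intro (A →ᶠ B)  s       = ⌜⌝-intro B ∘ s ∘ ⌜⌝-elim A

    ⌜⌝-elim : ∀ {w} A → w ⊨ ⌜ A ⌝ → w ⊨ A
    ⌜⌝-elim (atom p)  s       = s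
    ⌜⌝-elim (¬ᶠ A)    s       = s ∘ ⌜⌝-intro A
    ⌜⌝-elim (A ∧ᶠ B)  (s , t) = ⌜⌝-elim A s , ⌜⌝-elim B t
    ⌜⌝-elim (A ∨ᶠ B)  s       = λ k → s
      [ k ∘ inj₁ ∘ ⌜⌝-elim A , k ∘ inj₂ ∘ ⌜⌝-elim B ]′
    ⌜⌝-elim (A →ᶠ B)  s       = ⌜⌝-elim B ∘ s ∘ ⌜⌝-intro A

  -- The worlds w and v are arbitrary: conditionals are global.
  ⊩-^∣~± : ∀ {w v} {Γ : Node ATM} → w ⊩ Γ → v ⊩ Γ ^∣~±
  ⊩-^∣~± s _ (inj₁ (A , B , refl , F∈Γ)) = s _ F∈Γ
  ⊩-^∣~± s _ (inj₂ (A , B , refl , F∈Γ)) = s _ F∈Γ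

  ⊩-^□ : ∀ {w v} {Γ : Node ATM} → v < w → w ⊩ Γ → v ⊩ Γ ^□
  ⊩-^□ v<w s _ (A , refl , □¬A∈Γ) u u<v = s _ □¬A∈Γ u (trans u<v v<w)

  ⊩-^□↓ : ∀ {w v} {Γ : Node ATM} → v < w → w ⊩ Γ → v ⊩ Γ ^□↓
  ⊩-^□↓ v<w s _ (A , refl , □¬A∈Γ) = s _ □¬A∈Γ _ v<w ∘ ⌜⌝-elim A

  ⊨-stable : ∀ {k w} (F : Formula ATM k) → ¬ ¬ (w ⊨ F) → w ⊨ F
  ⊨-stable (atom p) h k = h λ f → f k
  ⊨-stable (¬ᶠ F)   h f = h λ ¬f → ¬f f
  ⊨-stable (F ∧ᶠ G) h =
    ⊨-stable F (λ k → h (k ∘ proj₁)) , ⊨-stable G (λ k → h (k ∘ proj₂))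
  ⊨-stable (F ∨ᶠ G) h k = h λ f → f k
  ⊨-stable (F →ᶠ G) h f = ⊨-stable G λ k → h λ g → k (g f)
  ⊨-stable (A ∣~ B) h v v-min = ⊨-stable B λ k → h λ f → k (f v v-min)
  ⊨-stable (□¬ A)   h v v<w v⊨A = h λ f → f v v<w v⊨A

  -- A false □¬ A has a minimal A-world as a counterexample.
  ¬□¬⇒min-below : ∀ {w} A → ¬ (w ⊨ □¬ A) → ¬ ¬ (∃[ v ] v ∈ Min A × v < w)
  ¬□¬⇒min-below A ¬□ k = ¬□ λ u u<w u⊨A → smooth A u u⊨A
    [ (λ u-min → k (u , u-min , u<w))
    , (λ (v , v-min , v<u) → k (v , v-min , trans v<u u<w)) ]′

  -- Every rule preserves satisfiability within M, possibly at another world.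
  rule-sound : ∀ {w} {Δ : Node ATM} {Δs} → Δ ⇝ Δs → w ⊩ Δ →
               ¬ ¬ (∃[ v ] Any (v ⊩_) Δs)
  rule-sound ([¬¬] Γ F) s k = ⊩-principal s λ f →
    k (_ , here (⊩-extend (⊩-context s) f))
  rule-sound ([∧⁺] Γ F G) s k = let (f , g) = ⊩-principal s in
    k (_ , here (⊩-extend (⊩-extend (⊩-context s) f) g))
  -- A classical case split on F: the first conclusion serves if F fails, and
  -- the proof that F fails may assume F while refuting the second conclusion.
  -- The rules [→⁺] and [∣~⁺] use the same split.
  rule-sound ([∧⁻] Γ F G) s k =
    k (_ , here (⊩-extend (⊩-context s) λ f →
    k (_ , there (here (⊩-extend (⊩-context s) λ g →
    ⊩-principal s (f , g))))))
  rule-sound ([∨⁺] Γ F G) s k = ⊩-principal s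
    [ (λ f → k (_ , here (⊩-extend (⊩-context s) f)))
    , (λ g → k (_ , there (here (⊩-extend (⊩-context s) g)))) ]′
  rule-sound ([∨⁻] Γ F G) s k =
    k (_ , here (⊩-extend (⊩-extend (⊩-context s)
      (λ f → ⊩-principal s λ j → j (inj₁ f)))
      (λ g → ⊩-principal s λ j → j (inj₂ g))))
  rule-sound ([→⁺] Γ F G) s k =
    k (_ , here (⊩-extend (⊩-context s) λ f →
    k (_ , there (here (⊩-extend (⊩-context s) (⊩-principal s f))))))
  rule-sound ([→⁻] Γ F G) s k = ⊩-principal s λ f → ⊥-elim
    (k (_ , here (⊩-extend (⊩-extend (⊩-context s) f)
      λ g → ⊩-principal s λ _ → g)))
  -- Either w refutes A, or w satisfies A without being minimal, or w is a
  -- minimal A-world and hence satisfies B.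
  rule-sound ([∣~⁺] Γ A B) s k =
    k (_ , here (conclude λ w⊨⌜A⌝ →
    k (_ , there (here (conclude λ w⊨□¬A →
    k (_ , there (there (here (conclude
      (⌜⌝-intro B (⊩-principal s _ (⌜⌝-elim A w⊨⌜A⌝ , w⊨□¬A))))))))))))
    where
    conclude : ∀ {F} → _ ⊨ F → _ ⊩ (Γ ,, F ,, A ∣~ B)
    conclude f = ⊩-extend (⊩-extend (⊩-context s) f) (⊩-principal s)
  rule-sound ([∣~⁻] Γ A B) s k = ⊩-principal s λ v (v⊨A , v⊨□¬A) →
    ⊨-stable B λ v⊭B →
    k (v , here (⊩-extend (⊩-extend (⊩-extend
      (⊩-^∣~± (⊩-context s)) (⌜⌝-intro A v⊨A)) v⊨□¬A) (v⊭B ∘ ⌜⌝-elim B)))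
  rule-sound ([□⁻] Γ A) s k = ¬□¬⇒min-below A (⊩-principal s)
    λ (v , (v⊨A , v⊨□¬A) , v<w) →
    k (v , here (⊩-extend (⊩-extend
      (λ F → [ ⊩-^□ v<w (⊩-context s) F
             , [ ⊩-^□↓ v<w (⊩-context s) F , ⊩-^∣~± (⊩-context s) F ]′ ]′)
      (⌜⌝-intro A v⊨A)) v⊨□¬A))

  -- Follows a satisfied branch upwards, by induction on the tableau.
  mutual
    satisfied⇒¬closed : ∀ {w} {Γ : Node ATM} (t : Tableau Γ) →
                        w ⊩ Γ → ¬ Closed t
    satisfied⇒¬closed leaf s closed with closed end
    ... | here ax = ¬-⊩-axiom s ax
    satisfied⇒¬closed (node (_ , Δ⊆Γ) r ts) s closed =
      rule-sound r (⊩-antitone Δ⊆Γ s) λ (_ , s′) →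
      satisfied⇒¬all-closed ts s′ λ i b →
      -- The root of this tableau is satisfied, so the axiom on the branch
      -- through child i occurs within that child.
      tail (¬-⊩-axiom s) (closed (step i b))

    satisfied⇒¬all-closed :
      ∀ {w} {Δs : List (Node ATM)} (ts : All Tableau Δs) → Any (w ⊩_) Δs →
      ¬ (∀ {Δ} (i : Δ List.∈ Δs) → Closed (All.lookup ts i))
    satisfied⇒¬all-closed (t ∷ _)  (here s)   closed =
      satisfied⇒¬closed t s (closed (here refl))
    satisfied⇒¬all-closed (_ ∷ ts) (there s) closed =
      satisfied⇒¬all-closed ts s λ i → closed (there i)

theorem3p4 : ∀ {a : Level} (ℓ : Level) {ATM : Set a} (Γ : Node ATM) →
    (Σ[ t ∈ Tableau Γ ] Closed t) → ¬ Satisfiable ℓ Γ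
theorem3p4 ℓ Γ (t , closed) (M , w , s) = satisfied⇒¬closed M t s closed
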